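{- Let $t \geq 3$ be an integer. For every integer $i \in \{0,1,\ldots,t-1\}$ and every integer $s$ with $2^{t+1}-2^{t-i} < s < 2^{t+1}-2^{t-i-1}$, there does not exist, for any integer $v > t+1$, a Steiner $t$-$(v,t+1)$ trade of volume $s$.
   Context: Let $0<t<k<v$ be natural numbers and let $X$ be a set with $v$ elements. For $0 \le j \le v$, $P_j(X)$ denotes the set of all $j$-element subsets of $X$; elements of $P_k(X)$ are called blocks. A $t$-$(v,k)$ trade $T=\{T_1,T_2\}$ consists of two disjoint collections $T_1,T_2$ of blocks (repeated blocks within $T_1$ or within $T_2$ are allowed in general, i.e. they are finite multisets with no common block) such that every element of $P_t(X)$ is contained in the same number of blocks of $T_1$ as of $T_2$ (counted with multiplicity). Then $|T_1|=|T_2|$, and this common number is called the volume of $T$. A $t$-$(v,k)$ trade is called a Steiner $t$-$(v,k)$ trade if every element of $P_t(X)$ is contained in at most one block of $T_1$ and in at most one block of $T_2$. A Steiner $t$-$(v,t+1)$ trade is the case $k=t+1$. -}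

module Defs where

open import Data.Fin.Subset using (Subset; _⊆_; ∣_∣)
open import Data.Fin.Subset.Properties using (_⊆?_)
open import Data.List.Base using (List; filter; length)
open import Data.List.Relation.Binary.Disjoint.Propositional using (Disjoint)
open import Data.List.Relation.Unary.All using (All)
open import Data.Nat.Base using (ℕ; _≤_)
open import Data.Product.Base using (_×_)
open import Relation.Binary.PropositionalEquality.Core using (_≡_)

-- The v-element set X is Fin v. A finite multiset of blocks is a list:
-- repetitions are allowed, and every notion below ignores the order.

degree : ∀ {v} → Subset v → List (Subset v) → ℕ
degree S 𝓑 = length (filter (S ⊆?_) 𝓑)

record Trade (t v k : ℕ) : Set where
  field
    T₁ T₂    : List (Subset v)
    blocks₁  : All (λ B → ∣ B ∣ ≡ k) T₁
    blocks₂  : All (λ B → ∣ B ∣ ≡ k) T₂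
    disjoint : Disjoint T₁ T₂
    balanced : ∀ (S : Subset v) → ∣ S ∣ ≡ t → degree S T₁ ≡ degree S T₂

  -- For t ≤ k, double counting of the pairs S ⊆ B with ∣ S ∣ ≡ t shows that
  -- length T₂ is the same number.
  volume : ℕ
  volume = length T₁

open Trade public using (volume)

IsSteiner : ∀ {t v k} → Trade t v k → Set
IsSteiner {t} {v} T =
  ∀ (S : Subset v) → ∣ S ∣ ≡ t → degree S T₁ ≤ 1 × degree S T₂ ≤ 1
  where open Trade T

{-# OPTIONS --safe #-}

-- The blocks of T₁ and T₂ together form a set A of 2 s points of 𝔽₂^v, on which
-- every polynomial of degree ≤ t has even sum; thus A is a word of a Reed–Muller
-- code with minimum weight 2^(t+1).  By the Kasami–Tokura gap theorem its weight,
-- if smaller than 2^(t+2), is 2^(t+2) − 2^j.  This follows by induction on t.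
-- Put d = 2^(t+1) and |A| = 2 d − e, and suppose that e is not a power of 2.  Every
-- hyperplane cuts A into two words of lower level, and by induction the smaller
-- has d − 2^c points, where e < 2^c or e = 2^c + 2^b with b < c.  Choosing the
-- larger half is linear in the functional: otherwise three smaller halves would
-- meet in d/2 − 2^l points, whence 2^c₁ + 2^c₂ + 2^c₃ = e + 2^(l+1), which is
-- impossible.  So there is a point p such that every functional χ has
-- χ(q) = χ(p) for more than half of the q ∈ A.  But averaged over all χ, at most
-- (|A| + 1) / 2 points of A agree with p, and |A| is even.
module Submission where

open import Defs
open import Data.Nat.Base using (ℕ; _+_; _∸_; _^_; _≤_; _<_; _>_)
open import Data.Product.Base using (_×_; ∃-syntax)
open import Relation.Binary.PropositionalEquality.Core using (_≡_)
open import Relation.Nullary.Negation.Core using (¬_)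

open import Data.Bool.Base using (Bool; true; false; _∧_; _xor_; not)
open import Data.Bool.Properties using (_≟_; ¬-not; not-involutive; ∨-identityʳ; xor-annihilates-not; xor-same)
open import Data.Empty using (⊥; ⊥-elim)
open import Data.Fin.Base using (Fin; zero; suc)
open import Data.Fin.Subset using (Subset; _⊆_; _∪_; ⁅_⁆; ∣_∣)
import Data.Fin.Subset as Subset
open import Data.Fin.Subset.Properties
open import Data.List.Base using (List; []; _∷_; _++_; map; filter; length; allFin; tabulate)
import Data.List.Membership.Propositional as List
open import Data.List.Relation.Binary.Disjoint.Propositional using (Disjoint)
open import Data.List.Properties using (map-∘; map-tabulate; map-++; length-++)
open import Data.List.Relation.Unary.All as All using (All; []; _∷_)
open import Data.List.Relation.Unary.Any using (here; there)
open import Data.Nat.Base using (zero; suc; _*_; z≤n; s≤s; >-nonZero)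
open import Data.Nat.Divisibility
open import Data.Nat.ListAction using (sum)
open import Data.Nat.ListAction.Properties using (sum-++)
open import Data.Nat.Properties hiding (_≟_)
import Data.Nat.Properties as ℕ
open import Data.Nat.Tactic.RingSolver using (solve-∀)
open import Data.Product.Base using (_,_; proj₁; proj₂)
open import Data.Sum.Base using (_⊎_; inj₁; inj₂)
open import Data.Vec.Base using ([]; _∷_; head; tail; lookup; zipWith)
open import Data.Vec.Properties using (≡-dec; lookup⇒[]=; []=⇒lookup)
open import Function.Base using (_∘_; case_of_)
open import Function.Bundles using (mk⇔)
open import Relation.Binary.PropositionalEquality hiding ([_])
open import Relation.Nullary.Decidable.Core using (Dec; yes; no; does)
open import Relation.Nullary.Decidable using (does-⇔; dec-true; dec-false)
open import Relation.Unary using (Decidable)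

-- Finite sums of natural numbers over lists

⟦_⟧ : Bool → ℕ
⟦ false ⟧ = 0
⟦ true  ⟧ = 1

private
  variable
    A B : Set

∑ : List A → (A → ℕ) → ℕ
∑ xs f = sum (map f xs)

∑-cong : ∀ {f g : A → ℕ} (xs : List A) → (∀ x → f x ≡ g x) → ∑ xs f ≡ ∑ xs g
∑-cong []       f≗g = refl
∑-cong (x ∷ xs) f≗g = cong₂ _+_ (f≗g x) (∑-cong xs f≗g)

∑-mono : ∀ {f g : A → ℕ} (xs : List A) → (∀ x → f x ≤ g x) → ∑ xs f ≤ ∑ xs g
∑-mono []       f≤g = z≤n
∑-mono (x ∷ xs) f≤g = +-mono-≤ (f≤g x) (∑-mono xs f≤g)

∑-+ : ∀ (f g : A → ℕ) (xs : List A) → ∑ xs (λ x → f x + g x) ≡ ∑ xs f + ∑ xs g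
∑-+ f g []       = refl
∑-+ f g (x ∷ xs) = trans (cong (f x + g x +_) (∑-+ f g xs))
  (interchange (f x) (g x) (∑ xs f) (∑ xs g))
  where
  interchange : ∀ a b c d → a + b + (c + d) ≡ a + c + (b + d)
  interchange = solve-∀

∑-*ˡ : ∀ k (f : A → ℕ) (xs : List A) → ∑ xs (λ x → k * f x) ≡ k * ∑ xs f
∑-*ˡ k f []       = sym (*-zeroʳ k)
∑-*ˡ k f (x ∷ xs) = trans (cong (k * f x +_) (∑-*ˡ k f xs)) (sym (*-distribˡ-+ k _ _))

∑-*ʳ : ∀ k (f : A → ℕ) (xs : List A) → ∑ xs (λ x → f x * k) ≡ ∑ xs f * k
∑-*ʳ k f xs = trans (∑-cong xs (λ x → *-comm (f x) k)) (trans (∑-*ˡ k f xs) (*-comm k _))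

∑-const : ∀ k (xs : List A) → ∑ xs (λ _ → k) ≡ length xs * k
∑-const k []       = refl
∑-const k (x ∷ xs) = cong (k +_) (∑-const k xs)

∑-++ : ∀ (f : A → ℕ) (xs ys : List A) → ∑ (xs ++ ys) f ≡ ∑ xs f + ∑ ys f
∑-++ f xs ys = trans (cong sum (map-++ f xs ys)) (sum-++ (map f xs) (map f ys))

∑-map : ∀ (f : A → ℕ) (h : B → A) (ys : List B) → ∑ (map h ys) f ≡ ∑ ys (f ∘ h)
∑-map f h ys = cong sum (sym (map-∘ ys))

∑-swap : ∀ (f : A → B → ℕ) (xs : List A) (ys : List B) →
  ∑ xs (λ x → ∑ ys (f x)) ≡ ∑ ys (λ y → ∑ xs (λ x → f x y))
∑-swap f []       ys = sym (trans (∑-const 0 ys) (*-zeroʳ (length ys)))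
∑-swap f (x ∷ xs) ys = trans (cong (∑ ys (f x) +_) (∑-swap f xs ys))
  (sym (∑-+ (f x) (λ y → ∑ xs (λ x → f x y)) ys))

∑-1 : ∀ (xs : List A) → ∑ xs (λ _ → 1) ≡ length xs
∑-1 xs = trans (∑-const 1 xs) (*-identityʳ (length xs))

module _ {P : A → Set} (P? : Decidable P) where

  ∑-filter : ∀ (f : A → ℕ) (xs : List A) →
    ∑ (filter P? xs) f ≡ ∑ xs (λ x → ⟦ does (P? x) ⟧ * f x)
  ∑-filter f []       = refl
  ∑-filter f (x ∷ xs) with does (P? x)
  ... | false = ∑-filter f xs
  ... | true  = cong₂ _+_ (sym (+-identityʳ (f x))) (∑-filter f xs)

  length-filter : ∀ (xs : List A) → length (filter P? xs) ≡ ∑ xs (λ x → ⟦ does (P? x) ⟧)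
  length-filter xs = begin
    length (filter P? xs)                  ≡⟨ ∑-1 (filter P? xs) ⟨
    ∑ (filter P? xs) (λ _ → 1)             ≡⟨ ∑-filter (λ _ → 1) xs ⟩
    ∑ xs (λ x → ⟦ does (P? x) ⟧ * 1)       ≡⟨ ∑-cong xs (λ x → *-identityʳ _) ⟩
    ∑ xs (λ x → ⟦ does (P? x) ⟧)           ∎
    where open ≡-Reasoning

-- Indicators and degrees of point sets

[_∈_] : ∀ {v} → Fin v → Subset v → ℕ
[ i ∈ q ] = ⟦ lookup q i ⟧

-- As a function of `q` this is the monomial over 𝔽₂ whose variables are the elements of `S`, so
-- degrees modulo 2 are sums of monomials over a word.
[_⊆_] : ∀ {v} → Subset v → Subset v → ℕ
[ S ⊆ q ] = ⟦ does (S ⊆? q) ⟧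

degree-∑ : ∀ {v} (S : Subset v) A → degree S A ≡ ∑ A [ S ⊆_]
degree-∑ S A = length-filter (S ⊆?_) A

degree-++ : ∀ {v} (S : Subset v) A B → degree S (A ++ B) ≡ degree S A + degree S B
degree-++ S A B = begin
  degree S (A ++ B)              ≡⟨ degree-∑ S (A ++ B) ⟩
  ∑ (A ++ B) [ S ⊆_]             ≡⟨ ∑-++ [ S ⊆_] A B ⟩
  ∑ A [ S ⊆_] + ∑ B [ S ⊆_]      ≡⟨ cong₂ _+_ (degree-∑ S A) (degree-∑ S B) ⟨
  degree S A + degree S B        ∎
  where open ≡-Reasoning

degree-⊥ : ∀ {v} (A : List (Subset v)) → degree Subset.⊥ A ≡ length A
degree-⊥ A = trans (degree-∑ Subset.⊥ A)
  (trans (∑-cong A (λ q → cong ⟦_⟧ (dec-true (Subset.⊥ ⊆? q) ⊥⊆))) (∑-1 A))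

-- Adjoining `i` multiplies the monomial by the `i`-th coordinate. For `i` already in `S` this
-- changes nothing, since coordinates are idempotent.
∪⁅⁆-⊆ : ∀ {v} (S q : Subset v) i → [ S ∪ ⁅ i ⁆ ⊆ q ] ≡ [ i ∈ q ] * [ S ⊆ q ]
∪⁅⁆-⊆ S q i with lookup q i in eq
... | true  = trans (cong ⟦_⟧ (does-⇔ (mk⇔ to from) (S ∪ ⁅ i ⁆ ⊆? q) (S ⊆? q)))
                    (sym (+-identityʳ _))
  where
  to : S ∪ ⁅ i ⁆ ⊆ q → S ⊆ q
  to Si⊆q x∈S = Si⊆q (p⊆p∪q ⁅ i ⁆ x∈S)
  from : S ⊆ q → S ∪ ⁅ i ⁆ ⊆ q
  from S⊆q x∈Si with x∈p∪q⁻ S ⁅ i ⁆ x∈Si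
  ... | inj₁ x∈S = S⊆q x∈S
  ... | inj₂ x∈i rewrite x∈⁅y⁆⇒x≡y i x∈i = lookup⇒[]= i q eq
... | false = cong ⟦_⟧ (dec-false (S ∪ ⁅ i ⁆ ⊆? q) λ Si⊆q →
  case trans (sym eq) ([]=⇒lookup (Si⊆q (q⊆p∪q S ⁅ i ⁆ (x∈⁅x⁆ i)))) of λ ())

∣∪⁅⁆∣ : ∀ {v} (S : Subset v) i → lookup S i ≡ false → ∣ S ∪ ⁅ i ⁆ ∣ ≡ suc ∣ S ∣
∣∪⁅⁆∣ (false ∷ S) zero    eq = cong (suc ∘ ∣_∣) (∪-identityʳ S)
∣∪⁅⁆∣ (false ∷ S) (suc i) eq = ∣∪⁅⁆∣ S i eq
∣∪⁅⁆∣ (true  ∷ S) (suc i) eq = cong suc (∣∪⁅⁆∣ S i eq)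

∪⁅⁆-absorb : ∀ {v} (S : Subset v) i → lookup S i ≡ true → S ∪ ⁅ i ⁆ ≡ S
∪⁅⁆-absorb (true ∷ S) zero    eq = cong (true ∷_) (∪-identityʳ S)
∪⁅⁆-absorb (x    ∷ S) (suc i) eq = cong₂ _∷_ (∨-identityʳ x) (∪⁅⁆-absorb S i eq)

∣∪⁅⁆∣≤ : ∀ {v} (S : Subset v) i → ∣ S ∪ ⁅ i ⁆ ∣ ≤ suc ∣ S ∣
∣∪⁅⁆∣≤ S i with lookup S i in eq
... | false = ≤-reflexive (∣∪⁅⁆∣ S i eq)
... | true  = ≤-trans (≤-reflexive (cong ∣_∣ (∪⁅⁆-absorb S i eq))) (n≤1+n _)

∑-allFin : ∀ {v} (q : Subset v) → ∑ (allFin v) [_∈ q ] ≡ ∣ q ∣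
∑-allFin []                = refl
∑-allFin {suc v} (x ∷ q) = trans (cong₂ _+_ refl tail-sum) (split x)
  where
  tail-sum : ∑ (tabulate suc) [_∈ x ∷ q ] ≡ ∣ q ∣
  tail-sum = trans (cong sum (trans (map-tabulate suc [_∈ x ∷ q ])
                                    (sym (map-tabulate (λ i → i) [_∈ q ]))))
                   (∑-allFin q)
  split : ∀ x → ⟦ x ⟧ + ∣ q ∣ ≡ ∣ x ∷ q ∣
  split false = refl
  split true  = refl

-- Equivalently, every polynomial over 𝔽₂ of degree < n has even sum on A.
Null : ∀ {v} → ℕ → List (Subset v) → Set
Null {v} n A = ∀ (S : Subset v) → ∣ S ∣ < n → 2 ∣ degree S A

-- Hyperplane sections of words

point? : ∀ {v} (p q : Subset v) → Dec (p ≡ q)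
point? = ≡-dec _≟_

[_≈_] : ∀ {v} → Subset v → Subset v → ℕ
[ p ≈ q ] = ⟦ does (point? p q) ⟧

-- Makes the list a genuine set, so that its length is the weight of a word.
Simple : ∀ {v} → List (Subset v) → Set
Simple {v} A = ∀ (p : Subset v) → ∑ A [ p ≈_] ≤ 1

-- The standard bilinear form over 𝔽₂, with `χ` as the linear functional. Matching on `χ` alone lets
-- it unfold at an opaque vector, as in `evenOn-dot`.
dot : ∀ {v} → Subset v → Subset v → Bool
dot []      q = false
dot (x ∷ χ) q = (x ∧ head q) xor dot χ (tail q)

section : ∀ {v} → Subset v → Bool → List (Subset v) → List (Subset v)
section χ b = filter (λ q → dot χ q ≟ b)

length-section : ∀ {v} (χ : Subset v) b A →
  length (section χ b A) ≡ ∑ A (λ q → ⟦ does (dot χ q ≟ b) ⟧)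
length-section χ b = length-filter (λ q → dot χ q ≟ b)

⟦⟧*≤ : ∀ b n → ⟦ b ⟧ * n ≤ n
⟦⟧*≤ false n = z≤n
⟦⟧*≤ true  n = ≤-reflexive (+-identityʳ n)

simple-section : ∀ {v} (χ : Subset v) b A → Simple A → Simple (section χ b A)
simple-section χ b A simple p = begin
  ∑ (section χ b A) [ p ≈_]                              ≡⟨ ∑-filter (λ q → dot χ q ≟ b) [ p ≈_] A ⟩
  ∑ A (λ q → ⟦ does (dot χ q ≟ b) ⟧ * [ p ≈ q ])         ≤⟨ ∑-mono A (λ q → ⟦⟧*≤ (does (dot χ q ≟ b)) _) ⟩
  ∑ A [ p ≈_]                                            ≤⟨ simple p ⟩
  1                                                      ∎
  where open ≤-Reasoning

module _ {X : Set} (A : List X) (f : X → ℕ) where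

  EvenOn : (X → Bool) → Set
  EvenOn g = 2 ∣ ∑ A (λ q → ⟦ g q ⟧ * f q)

  evenOn-cong : ∀ {g h} → (∀ q → g q ≡ h q) → EvenOn g → EvenOn h
  evenOn-cong g≗h = subst (2 ∣_) (∑-cong A (λ q → cong (λ b → ⟦ b ⟧ * f q) (g≗h q)))

  -- Over the integers a + b = (a xor b) + 2 a b for bits a and b, so passing from the sum to `xor`
  -- changes the weighted count by an even number.
  evenOn-xor : ∀ g h → EvenOn g → EvenOn h → EvenOn (λ q → g q xor h q)
  evenOn-xor g h eg eh = ∣m+n∣m⇒∣n
    (subst (2 ∣_) (sym eq) (∣m∣n⇒∣m+n eg eh))
    (m∣m*n (∑ A (λ q → ⟦ g q ∧ h q ⟧ * f q)))
    where
    open ≡-Reasoning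
    pointwise : ∀ a b m → 2 * (⟦ a ∧ b ⟧ * m) + ⟦ a xor b ⟧ * m ≡ ⟦ a ⟧ * m + ⟦ b ⟧ * m
    pointwise false false m = refl
    pointwise false true  m = refl
    pointwise true  false m = sym (+-identityʳ _)
    pointwise true  true  m = double m where
      double : ∀ m → 2 * (1 * m) + 0 * m ≡ 1 * m + 1 * m
      double = solve-∀
    eq : 2 * ∑ A (λ q → ⟦ g q ∧ h q ⟧ * f q) + ∑ A (λ q → ⟦ g q xor h q ⟧ * f q)
       ≡ ∑ A (λ q → ⟦ g q ⟧ * f q) + ∑ A (λ q → ⟦ h q ⟧ * f q)
    eq = begin
      2 * ∑ A (λ q → ⟦ g q ∧ h q ⟧ * f q) + ∑ A (λ q → ⟦ g q xor h q ⟧ * f q)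
        ≡⟨ cong (_+ ∑ A (λ q → ⟦ g q xor h q ⟧ * f q)) (∑-*ˡ 2 (λ q → ⟦ g q ∧ h q ⟧ * f q) A) ⟨
      ∑ A (λ q → 2 * (⟦ g q ∧ h q ⟧ * f q)) + ∑ A (λ q → ⟦ g q xor h q ⟧ * f q)
        ≡⟨ ∑-+ (λ q → 2 * (⟦ g q ∧ h q ⟧ * f q)) (λ q → ⟦ g q xor h q ⟧ * f q) A ⟨
      ∑ A (λ q → 2 * (⟦ g q ∧ h q ⟧ * f q) + ⟦ g q xor h q ⟧ * f q)
        ≡⟨ ∑-cong A (λ q → pointwise (g q) (h q) (f q)) ⟩
      ∑ A (λ q → ⟦ g q ⟧ * f q + ⟦ h q ⟧ * f q)
        ≡⟨ ∑-+ (λ q → ⟦ g q ⟧ * f q) (λ q → ⟦ h q ⟧ * f q) A ⟩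
      ∑ A (λ q → ⟦ g q ⟧ * f q) + ∑ A (λ q → ⟦ h q ⟧ * f q) ∎

  evenOn-false : EvenOn (λ _ → false)
  evenOn-false = subst (2 ∣_) (sym (trans (∑-const 0 A) (*-zeroʳ (length A)))) (2 ∣0)

  evenOn-const : 2 ∣ ∑ A f → ∀ b → EvenOn (λ _ → b)
  evenOn-const even false = evenOn-false
  evenOn-const even true  = subst (2 ∣_) (∑-cong A (λ q → sym (+-identityʳ (f q)))) even

  evenOn-dot : ∀ {m} (χ : Subset m) (w : X → Subset m) →
    (∀ i → EvenOn (λ q → lookup (w q) i)) → EvenOn (λ q → dot χ (w q))
  evenOn-dot []      w even = evenOn-false
  evenOn-dot (x ∷ χ) w even = evenOn-xor (λ q → x ∧ head (w q)) (λ q → dot χ (tail (w q)))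
    (first x) (evenOn-dot χ (tail ∘ w) λ i → evenOn-cong (λ q → lookup-suc (w q) i) (even (suc i)))
    where
    lookup-suc : ∀ {m} (p : Subset (suc m)) i → lookup p (suc i) ≡ lookup (tail p) i
    lookup-suc (_ ∷ _) i = refl
    lookup-zero : ∀ {m} (p : Subset (suc m)) → lookup p zero ≡ head p
    lookup-zero (_ ∷ _) = refl
    first : ∀ x → EvenOn (λ q → x ∧ head (w q))
    first false = evenOn-false
    first true  = evenOn-cong (λ q → lookup-zero (w q)) (even zero)

-- A sum over a section is a sum over `A` of the product with an affine function. The product raises
-- the degree by at most one, which costs one level.
null-section : ∀ {v} n (χ : Subset v) b A → Null (suc n) A → Null n (section χ b A)
null-section n χ b A null S ∣S∣<n = subst (2 ∣_) (sym eq)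
  -- The indicator of the section is `not b xor dot χ q`, so by additivity only constants and single
  -- coordinates remain.
  (evenOn-cong A [ S ⊆_] (λ q → does-≟ b (dot χ q))
    (evenOn-xor A [ S ⊆_] (λ _ → not b) (dot χ)
      (evenOn-const A [ S ⊆_] (subst (2 ∣_) (degree-∑ S A) (null S (m≤n⇒m≤1+n ∣S∣<n))) (not b))
      (evenOn-dot A [ S ⊆_] χ (λ q → q) coordinate)))
  where
  eq : degree S (section χ b A) ≡ ∑ A (λ q → ⟦ does (dot χ q ≟ b) ⟧ * [ S ⊆ q ])
  eq = trans (degree-∑ S (section χ b A)) (∑-filter (λ q → dot χ q ≟ b) [ S ⊆_] A)
  does-≟ : ∀ b x → not b xor x ≡ does (x ≟ b)
  does-≟ false false = refl
  does-≟ false true  = refl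
  does-≟ true  false = refl
  does-≟ true  true  = refl
  coordinate : ∀ i → EvenOn A [ S ⊆_] (λ q → lookup q i)
  coordinate i = subst (2 ∣_)
    (trans (degree-∑ (S ∪ ⁅ i ⁆) A) (∑-cong A (λ q → ∪⁅⁆-⊆ S q i)))
    (null (S ∪ ⁅ i ⁆) (≤-<-trans (∣∪⁅⁆∣≤ S i) (s≤s ∣S∣<n)))

-- Arithmetic of powers of two

2^-mono-< : ∀ {m n} → m < n → 2 ^ m < 2 ^ n
2^-mono-< = ^-monoʳ-< 2 (s≤s (s≤s z≤n))

2^-mono-≤ : ∀ {m n} → m ≤ n → 2 ^ m ≤ 2 ^ n
2^-mono-≤ = ^-monoʳ-≤ 2

2^-cancel-< : ∀ {m n} → 2 ^ m < 2 ^ n → m < n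
2^-cancel-< 2^m<2^n = ≰⇒> λ n≤m → <⇒≱ 2^m<2^n (2^-mono-≤ n≤m)

2^-suc : ∀ n → 2 ^ suc n ≡ 2 ^ n + 2 ^ n
2^-suc n = cong (2 ^ n +_) (+-identityʳ (2 ^ n))

IsPower : ℕ → Set
IsPower e = ∃[ j ] e ≡ 2 ^ j

isPower? : ∀ e → Dec (IsPower e)
-- The search may stop at `e`, because j ≤ 2^j = e.
isPower? e with anyUpTo? (λ j → e ℕ.≟ 2 ^ j) (suc e)
... | yes (j , _ , e≡2^j) = yes (j , e≡2^j)
... | no ¬p = no λ { (j , e≡2^j) → ¬p (j , s≤s (≤-trans (n≤2^n j) (≤-reflexive (sym e≡2^j))) , e≡2^j) }
  where
  n≤2^n : ∀ n → n ≤ 2 ^ n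
  n≤2^n zero    = z≤n
  n≤2^n (suc n) = begin
    1 + n             ≤⟨ +-mono-≤ (m^n>0 2 n) (n≤2^n n) ⟩
    2 ^ n + 2 ^ n     ≡⟨ 2^-suc n ⟨
    2 ^ suc n         ∎
    where open ≤-Reasoning

-- The possible relations between `e` and the smaller half d - 2^c of a word with 2 d - e points. In
-- the first case the larger half reaches d, in the second it has d - 2^b points.
Fits : ℕ → ℕ → Set
Fits e c = e < 2 ^ c ⊎ ∃[ b ] b < c × e ≡ 2 ^ c + 2 ^ b

fits⇒< : ∀ {e c} → Fits e c → e < 2 ^ c + 2 ^ c
fits⇒< {e} {c} (inj₁ e<2^c) = m≤n⇒m≤n+o (2 ^ c) e<2^c
fits⇒< {e} {c} (inj₂ (b , b<c , refl)) = +-monoʳ-< (2 ^ c) (2^-mono-< b<c)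

module _ {e l : ℕ} (0<e : 0 < e) where

  -- If e = 2^c₁ + 2^b, cancelling 2^c₁ leaves 2^b + 2^l = 2^c₂ + 2^c₃ with b < c₂: the left side is
  -- too small for l ≤ c₃ and too large otherwise. If e < 2^c₁, then 2^l lies strictly between 2^c₂
  -- + 2^c₃ and 2^c₁ + 2^c₂ + 2^c₃, where there is no power of two.
  sorted-powers-≢ : ∀ {c₁ c₂ c₃} → c₁ ≤ c₂ → c₂ ≤ c₃ → Fits e c₁ →
    e + 2 ^ l ≢ 2 ^ c₁ + (2 ^ c₂ + 2 ^ c₃)
  sorted-powers-≢ {c₁} {c₂} {c₃} c₁≤c₂ c₂≤c₃ (inj₂ (b , b<c₁ , refl)) eq
    with l ≤? c₃
  ... | yes l≤c₃ = <-irrefl cancelled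
                     (+-mono-<-≤ (2^-mono-< (<-≤-trans b<c₁ c₁≤c₂)) (2^-mono-≤ l≤c₃))
    where
    cancelled : 2 ^ b + 2 ^ l ≡ 2 ^ c₂ + 2 ^ c₃
    cancelled = +-cancelˡ-≡ (2 ^ c₁) _ _ (trans (sym (+-assoc (2 ^ c₁) (2 ^ b) (2 ^ l))) eq)
  ... | no l≰c₃ = <-irrefl (sym eq) (begin-strict
    2 ^ c₁ + (2 ^ c₂ + 2 ^ c₃)   ≤⟨ +-monoʳ-≤ (2 ^ c₁) (+-monoˡ-≤ (2 ^ c₃) (2^-mono-≤ c₂≤c₃)) ⟩
    2 ^ c₁ + (2 ^ c₃ + 2 ^ c₃)   ≡⟨ cong (2 ^ c₁ +_) (2^-suc c₃) ⟨
    2 ^ c₁ + 2 ^ suc c₃          ≤⟨ +-monoʳ-≤ (2 ^ c₁) (2^-mono-≤ (≰⇒> l≰c₃)) ⟩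
    2 ^ c₁ + 2 ^ l               <⟨ +-monoˡ-< (2 ^ l) (m<m+n (2 ^ c₁) (m^n>0 2 b)) ⟩
    2 ^ c₁ + 2 ^ b + 2 ^ l       ∎)
    where open ≤-Reasoning
  sorted-powers-≢ {c₁} {c₂} {c₃} c₁≤c₂ c₂≤c₃ (inj₁ e<2^c₁) eq with m≤n⇒m<n∨m≡n c₂≤c₃
  ... | inj₁ c₂<c₃ = <⇒≱ upper (begin
    2 ^ c₁ + (2 ^ c₂ + 2 ^ c₃)   ≤⟨ +-monoˡ-≤ (2 ^ c₂ + 2 ^ c₃) (2^-mono-≤ c₁≤c₂) ⟩
    2 ^ c₂ + (2 ^ c₂ + 2 ^ c₃)   ≡⟨ +-assoc (2 ^ c₂) (2 ^ c₂) (2 ^ c₃) ⟨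
    2 ^ c₂ + 2 ^ c₂ + 2 ^ c₃     ≡⟨ cong (_+ 2 ^ c₃) (2^-suc c₂) ⟨
    2 ^ suc c₂ + 2 ^ c₃          ≤⟨ +-monoˡ-≤ (2 ^ c₃) (2^-mono-≤ c₂<c₃) ⟩
    2 ^ c₃ + 2 ^ c₃              ≡⟨ 2^-suc c₃ ⟨
    2 ^ suc c₃                   ≤⟨ 2^-mono-≤ (2^-cancel-< {c₃} {l} (≤-<-trans (m≤n+m (2 ^ c₃) (2 ^ c₂)) lower)) ⟩
    2 ^ l                        ∎)
    where
    open ≤-Reasoning
    lower : 2 ^ c₂ + 2 ^ c₃ < 2 ^ l
    lower = ≰⇒> λ 2^l≤ → <-irrefl eq (+-mono-<-≤ e<2^c₁ 2^l≤)
    upper : 2 ^ l < 2 ^ c₁ + (2 ^ c₂ + 2 ^ c₃)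
    upper = subst (2 ^ l <_) eq (m<n+m (2 ^ l) 0<e)
  ... | inj₂ refl = <⇒≱ upper (begin
    -- Rounding 2^c₁ up to 2^(c₃+1) completes the sum to the next power that `l` can reach.
    2 ^ c₁ + (2 ^ c₃ + 2 ^ c₃)   ≤⟨ +-monoˡ-≤ (2 ^ c₃ + 2 ^ c₃) (2^-mono-≤ (m≤n⇒m≤1+n c₁≤c₂)) ⟩
    2 ^ suc c₃ + (2 ^ c₃ + 2 ^ c₃) ≡⟨ cong (2 ^ suc c₃ +_) (2^-suc c₃) ⟨
    2 ^ suc c₃ + 2 ^ suc c₃      ≡⟨ 2^-suc (suc c₃) ⟨
    2 ^ suc (suc c₃)             ≤⟨ 2^-mono-≤ (2^-cancel-< {suc c₃} {l} (≤-<-trans (≤-reflexive (2^-suc c₃)) lower)) ⟩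
    2 ^ l                        ∎)
    where
    open ≤-Reasoning
    lower : 2 ^ c₃ + 2 ^ c₃ < 2 ^ l
    lower = ≰⇒> λ 2^l≤ → <-irrefl eq (+-mono-<-≤ e<2^c₁ 2^l≤)
    upper : 2 ^ l < 2 ^ c₁ + (2 ^ c₃ + 2 ^ c₃)
    upper = subst (2 ^ l <_) eq (m<n+m (2 ^ l) 0<e)

  -- The equation is symmetric in the exponents, and whichever is smallest supplies the `Fits` for
  -- the sorted case.
  powers-≢ : ∀ {c₁ c₂ c₃} → Fits e c₁ → Fits e c₂ → Fits e c₃ →
    e + 2 ^ l ≢ 2 ^ c₁ + (2 ^ c₂ + 2 ^ c₃)
  powers-≢ {c₁} {c₂} {c₃} f₁ f₂ f₃ eq with ≤-total c₁ c₂ | ≤-total c₂ c₃ | ≤-total c₁ c₃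
  ... | inj₁ c₁≤c₂ | inj₁ c₂≤c₃ | _          = sorted-powers-≢ c₁≤c₂ c₂≤c₃ f₁ eq
  ... | inj₁ _     | inj₂ c₃≤c₂ | inj₁ c₁≤c₃ =
    sorted-powers-≢ c₁≤c₃ c₃≤c₂ f₁ (trans eq (swap₂₃ (2 ^ c₁) (2 ^ c₂) (2 ^ c₃)))
    where
    swap₂₃ : ∀ x y z → x + (y + z) ≡ x + (z + y)
    swap₂₃ = solve-∀
  ... | inj₁ c₁≤c₂ | inj₂ _     | inj₂ c₃≤c₁ =
    sorted-powers-≢ c₃≤c₁ c₁≤c₂ f₃ (trans eq (rotate (2 ^ c₁) (2 ^ c₂) (2 ^ c₃)))
    where
    rotate : ∀ x y z → x + (y + z) ≡ z + (x + y)
    rotate = solve-∀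
  ... | inj₂ c₂≤c₁ | inj₁ _     | inj₁ c₁≤c₃ =
    sorted-powers-≢ c₂≤c₁ c₁≤c₃ f₂ (trans eq (swap₁₂ (2 ^ c₁) (2 ^ c₂) (2 ^ c₃)))
    where
    swap₁₂ : ∀ x y z → x + (y + z) ≡ y + (x + z)
    swap₁₂ = solve-∀
  ... | inj₂ _     | inj₁ c₂≤c₃ | inj₂ c₃≤c₁ =
    sorted-powers-≢ c₂≤c₃ c₃≤c₁ f₂ (trans eq (rotate (2 ^ c₁) (2 ^ c₂) (2 ^ c₃)))
    where
    rotate : ∀ x y z → x + (y + z) ≡ y + (z + x)
    rotate = solve-∀
  ... | inj₂ c₂≤c₁ | inj₂ c₃≤c₂ | _          =
    sorted-powers-≢ c₃≤c₂ c₂≤c₁ f₃ (trans eq (reverse (2 ^ c₁) (2 ^ c₂) (2 ^ c₃)))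
    where
    reverse : ∀ x y z → x + (y + z) ≡ z + (y + x)
    reverse = solve-∀

-- As e > 0, the smaller part is below `d` and has the form d - 2^c. If M ≥ d, then e ≤ 2^c, and
-- equality would make `e` a power of two. If M = d - 2^b, then e = 2^c + 2^b, and b = c would make
-- it 2^(b+1).
half-split : ∀ {m M e d} → m + M + e ≡ d + d → 0 < e → m ≤ M →
  (m < d → ∃[ c ] m + 2 ^ c ≡ d) → (M < d → ∃[ b ] M + 2 ^ b ≡ d) → ¬ IsPower e →
  ∃[ c ] m + 2 ^ c ≡ d × Fits e c × m < M
half-split {m} {M} {e} {d} total 0<e m≤M small-m small-M e≢2^ with small-m m<d
  where
  m<d : m < d
  m<d = ≰⇒> λ d≤m → <-irrefl (sym total)
    (≤-<-trans (+-mono-≤ d≤m (≤-trans d≤m m≤M)) (m<m+n (m + M) 0<e))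
... | c , m+2^c≡d with M <? d
... | no M≮d = c , m+2^c≡d , inj₁ (≤∧≢⇒< e≤2^c λ e≡2^c → e≢2^ (c , e≡2^c)) , m<M
  where
  m<M : m < M
  m<M = <-≤-trans (subst (m <_) m+2^c≡d (m<m+n m (m^n>0 2 c))) (≮⇒≥ M≮d)
  e+M≡2^c+d : e + M ≡ 2 ^ c + d
  e+M≡2^c+d = +-cancelˡ-≡ m _ _ (trans (rearrange m e M)
    (trans total (trans (cong (_+ d) (sym m+2^c≡d)) (+-assoc m (2 ^ c) d))))
    where
    rearrange : ∀ m e M → m + (e + M) ≡ m + M + e
    rearrange = solve-∀
  e≤2^c : e ≤ 2 ^ c
  e≤2^c = +-cancelʳ-≤ d e (2 ^ c) (≤-trans (+-monoʳ-≤ e (≮⇒≥ M≮d)) (≤-reflexive e+M≡2^c+d))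
... | yes M<d with small-M M<d
... | b , M+2^b≡d = c , m+2^c≡d , inj₂ (b , b<c , e≡) , m<M
  where
  e≡ : e ≡ 2 ^ c + 2 ^ b
  e≡ = +-cancelˡ-≡ (m + M) _ _ (trans total (trans (cong₂ _+_ (sym m+2^c≡d) (sym M+2^b≡d))
    (rearrange m (2 ^ c) M (2 ^ b))))
    where
    rearrange : ∀ m x M y → m + x + (M + y) ≡ m + M + (x + y)
    rearrange = solve-∀
  b≤c : b ≤ c
  b≤c = ≮⇒≥ λ c<b → <-irrefl (trans m+2^c≡d (sym M+2^b≡d)) (+-mono-≤-< m≤M (2^-mono-< c<b))
  b<c : b < c
  b<c = ≤∧≢⇒< b≤c λ { refl → e≢2^ (suc b , trans e≡ (sym (2^-suc b))) }
  m<M : m < M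
  m<M = ≰⇒> λ M≤m → <-irrefl (trans M+2^b≡d (sym m+2^c≡d)) (+-mono-≤-< M≤m (2^-mono-< b<c))

-- Linear functionals on 𝔽₂^v and averages over them

_⊕_ : ∀ {v} → Subset v → Subset v → Subset v
_⊕_ = zipWith _xor_

dot-⊕ : ∀ {v} (χ ψ q : Subset v) → dot (χ ⊕ ψ) q ≡ dot χ q xor dot ψ q
dot-⊕ []      []      q       = refl
dot-⊕ (x ∷ χ) (y ∷ ψ) (z ∷ q) =
  trans (cong ((x xor y) ∧ z xor_) (dot-⊕ χ ψ q)) (interchange x y z (dot χ q) (dot ψ q))
  where
  interchange : ∀ x y z a b → (x xor y) ∧ z xor (a xor b) ≡ (x ∧ z xor a) xor (y ∧ z xor b)
  interchange false y     z     false b     = refl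
  interchange false false false true  b     = refl
  interchange false false true  true  b     = refl
  interchange false true  false true  b     = refl
  interchange false true  true  true  false = refl
  interchange false true  true  true  true  = refl
  interchange true  false false a     b     = refl
  interchange true  false true  false b     = refl
  interchange true  false true  true  false = refl
  interchange true  false true  true  true  = refl
  interchange true  true  false a     b     = refl
  interchange true  true  true  false false = refl
  interchange true  true  true  false true  = refl
  interchange true  true  true  true  false = refl
  interchange true  true  true  true  true  = refl

⊕-identityˡ : ∀ {v} (χ : Subset v) → Subset.⊥ ⊕ χ ≡ χ
⊕-identityˡ []      = refl
⊕-identityˡ (x ∷ χ) = cong (x ∷_) (⊕-identityˡ χ)

-- The space is its own double dual: the coordinates of `p` are the values of `M` at the standard
-- basis vectors.
linear⇒dot : ∀ {v} (M : Subset v → Bool) → (∀ χ ψ → M (χ ⊕ ψ) ≡ M χ xor M ψ) →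
  ∃[ p ] (∀ χ → M χ ≡ dot χ p)
linear⇒dot {zero} M linear = [] , λ { [] → trans (linear [] []) (xor-same (M [])) }
linear⇒dot {suc v} M linear with linear⇒dot (M ∘ (false ∷_)) (λ χ ψ → linear (false ∷ χ) (false ∷ ψ))
... | p , M≡dot = M (true ∷ Subset.⊥) ∷ p , λ
  { (false ∷ χ) → M≡dot χ
  ; (true  ∷ χ) → trans (cong (M ∘ (true ∷_)) (sym (⊕-identityˡ χ)))
      (trans (linear (true ∷ Subset.⊥) (false ∷ χ)) (cong (M (true ∷ Subset.⊥) xor_) (M≡dot χ))) }

cube : ∀ v → List (Subset v)
cube zero    = [] ∷ []
cube (suc v) = map (false ∷_) (cube v) ++ map (true ∷_) (cube v)

∑-cube : ∀ {v} (f : Subset (suc v) → ℕ) →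
  ∑ (cube (suc v)) f ≡ ∑ (cube v) (f ∘ (false ∷_)) + ∑ (cube v) (f ∘ (true ∷_))
∑-cube {v} f = trans (∑-++ f (map (false ∷_) (cube v)) (map (true ∷_) (cube v)))
  (cong₂ _+_ (∑-map f (false ∷_) (cube v)) (∑-map f (true ∷_) (cube v)))

length-cube : ∀ v → length (cube v) ≡ 2 ^ v
length-cube zero    = refl
length-cube (suc v) = begin
  length (cube (suc v))                        ≡⟨ ∑-1 (cube (suc v)) ⟨
  ∑ (cube (suc v)) (λ _ → 1)                   ≡⟨ ∑-cube {v} (λ _ → 1) ⟩
  ∑ (cube v) (λ _ → 1) + ∑ (cube v) (λ _ → 1)  ≡⟨ cong (λ n → n + n) (trans (∑-1 (cube v)) (length-cube v)) ⟩
  2 ^ v + 2 ^ v                                ≡⟨ 2^-suc v ⟨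
  2 ^ suc v                                    ∎
  where open ≡-Reasoning

agree : ∀ {v} → Subset v → Subset v → Subset v → ℕ
agree χ q p = ⟦ does (dot χ q ≟ dot χ p) ⟧

-- Induction on the dimension. With equal heads, the first coefficient of `χ` does not affect
-- agreement. With different heads, flipping that coefficient flips agreement, so exactly half of
-- the functionals agree.
∑-agree : ∀ {v} (q p : Subset v) →
  2 * ∑ (cube v) (λ χ → agree χ q p) ≤ 2 ^ v * (1 + [ p ≈ q ])
∑-agree []              []      = ≤-refl
∑-agree {suc v} (y ∷ q) (x ∷ p) = bound y x
  where
  Z : ℕ
  Z = ∑ (cube v) (λ χ → agree χ q p)
  same : ∀ b → 2 * ∑ (cube (suc v)) (λ χ → agree χ (b ∷ q) (b ∷ p)) ≤ 2 ^ suc v * (1 + [ p ≈ q ])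
  same b = begin
    2 * ∑ (cube (suc v)) (λ χ → agree χ (b ∷ q) (b ∷ p))
      ≡⟨ cong (2 *_) (trans (∑-cube (λ χ → agree χ (b ∷ q) (b ∷ p)))
           (cong (Z +_) (∑-cong (cube v) (λ χ → shift b (dot χ q) (dot χ p))))) ⟩
    2 * (Z + Z)                        ≡⟨ cong (λ n → 2 * (Z + n)) (+-identityʳ Z) ⟨
    2 * (2 * Z)                        ≤⟨ *-monoʳ-≤ 2 (∑-agree q p) ⟩
    2 * (2 ^ v * (1 + [ p ≈ q ]))      ≡⟨ *-assoc 2 (2 ^ v) _ ⟨
    2 ^ suc v * (1 + [ p ≈ q ])        ∎
    where
    open ≤-Reasoning
    shift : ∀ b x y → ⟦ does ((b xor x) ≟ (b xor y)) ⟧ ≡ ⟦ does (x ≟ y) ⟧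
    shift false x     y     = refl
    shift true  false false = refl
    shift true  false true  = refl
    shift true  true  false = refl
    shift true  true  true  = refl
  differ : ∀ b → 2 * ∑ (cube (suc v)) (λ χ → agree χ (b ∷ q) (not b ∷ p)) ≡ 2 ^ suc v * 1
  differ b = begin
    2 * ∑ (cube (suc v)) (λ χ → agree χ (b ∷ q) (not b ∷ p))
      ≡⟨ cong (2 *_) (∑-cube (λ χ → agree χ (b ∷ q) (not b ∷ p))) ⟩
    2 * (Z + ∑ (cube v) (λ χ → agree (true ∷ χ) (b ∷ q) (not b ∷ p)))
      ≡⟨ cong (2 *_) (∑-+ (λ χ → agree χ q p) (λ χ → agree (true ∷ χ) (b ∷ q) (not b ∷ p)) (cube v)) ⟨
    2 * ∑ (cube v) (λ χ → agree χ q p + agree (true ∷ χ) (b ∷ q) (not b ∷ p))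
      ≡⟨ cong (2 *_) (∑-cong (cube v) (λ χ → complement b (dot χ q) (dot χ p))) ⟩
    2 * ∑ (cube v) (λ χ → 1)
      ≡⟨ cong (2 *_) (trans (∑-1 (cube v)) (length-cube v)) ⟩
    2 ^ suc v
      ≡⟨ *-identityʳ (2 ^ suc v) ⟨
    2 ^ suc v * 1 ∎
    where
    open ≡-Reasoning
    complement : ∀ b x y →
      ⟦ does (x ≟ y) ⟧ + ⟦ does ((b xor x) ≟ (not b xor y)) ⟧ ≡ 1
    complement false false false = refl
    complement false false true  = refl
    complement false true  false = refl
    complement false true  true  = refl
    complement true  false false = refl
    complement true  false true  = refl
    complement true  true  false = refl
    complement true  true  true  = refl
  bound : ∀ y x → 2 * ∑ (cube (suc v)) (λ χ → agree χ (y ∷ q) (x ∷ p))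
                ≤ 2 ^ suc v * (1 + [ x ∷ p ≈ y ∷ q ])
  bound false false = same false
  bound true  true  = same true
  bound false true  = ≤-reflexive (differ false)
  bound true  false = ≤-reflexive (differ true)

-- Counting points in hyperplane sections

module _ {v} (A : List (Subset v)) where

  -- A point lies in the third section exactly when it lies in both or in neither of the first two.
  -- It is therefore counted three times if it lies in both, and once otherwise.
  minority-sum : ∀ χ ψ b₁ b₂ →
    length (section χ b₁ A) + (length (section ψ b₂ A) + length (section (χ ⊕ ψ) (b₁ xor b₂) A))
    ≡ length A + 2 * length (section ψ b₂ (section χ b₁ A))
  minority-sum χ ψ b₁ b₂ = begin
    length (section χ b₁ A) + (length (section ψ b₂ A) + length (section (χ ⊕ ψ) (b₁ xor b₂) A))
      ≡⟨ cong₂ _+_ (length-section χ b₁ A)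
           (cong₂ _+_ (length-section ψ b₂ A) (length-section (χ ⊕ ψ) (b₁ xor b₂) A)) ⟩
    ∑ A f + (∑ A g + ∑ A h)
      ≡⟨ cong (∑ A f +_) (∑-+ g h A) ⟨
    ∑ A f + ∑ A (λ q → g q + h q)
      ≡⟨ ∑-+ f (λ q → g q + h q) A ⟨
    ∑ A (λ q → f q + (g q + h q))
      ≡⟨ ∑-cong A pointwise ⟩
    ∑ A (λ q → 1 + 2 * (f q * g q))
      ≡⟨ ∑-+ (λ _ → 1) (λ q → 2 * (f q * g q)) A ⟩
    ∑ A (λ _ → 1) + ∑ A (λ q → 2 * (f q * g q))
      ≡⟨ cong₂ _+_ (∑-1 A) (∑-*ˡ 2 (λ q → f q * g q) A) ⟩
    length A + 2 * ∑ A (λ q → f q * g q)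
      ≡⟨ cong (λ n → length A + 2 * n) (trans (length-section ψ b₂ (section χ b₁ A))
           (∑-filter (λ q → dot χ q ≟ b₁) g A)) ⟨
    length A + 2 * length (section ψ b₂ (section χ b₁ A)) ∎
    where
    open ≡-Reasoning
    f g h : Subset v → ℕ
    f q = ⟦ does (dot χ q ≟ b₁) ⟧
    g q = ⟦ does (dot ψ q ≟ b₂) ⟧
    h q = ⟦ does (dot (χ ⊕ ψ) q ≟ (b₁ xor b₂)) ⟧
    cases : ∀ b₁ b₂ x y → ⟦ does (x ≟ b₁) ⟧ + (⟦ does (y ≟ b₂) ⟧ + ⟦ does ((x xor y) ≟ (b₁ xor b₂)) ⟧)
      ≡ 1 + 2 * (⟦ does (x ≟ b₁) ⟧ * ⟦ does (y ≟ b₂) ⟧)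
    cases false false false false = refl
    cases false false false true  = refl
    cases false false true  false = refl
    cases false false true  true  = refl
    cases false true  false false = refl
    cases false true  false true  = refl
    cases false true  true  false = refl
    cases false true  true  true  = refl
    cases true  false false false = refl
    cases true  false false true  = refl
    cases true  false true  false = refl
    cases true  false true  true  = refl
    cases true  true  false false = refl
    cases true  true  false true  = refl
    cases true  true  true  false = refl
    cases true  true  true  true  = refl
    pointwise : ∀ q → f q + (g q + h q) ≡ 1 + 2 * (f q * g q)
    pointwise q rewrite dot-⊕ χ ψ q = cases b₁ b₂ (dot χ q) (dot ψ q)

  length-sections : ∀ χ b → length (section χ b A) + length (section χ (not b) A) ≡ length A
  length-sections χ b = begin
    length (section χ b A) + length (section χ (not b) A)
      ≡⟨ cong₂ _+_ (length-section χ b A) (length-section χ (not b) A) ⟩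
    ∑ A (λ q → ⟦ does (dot χ q ≟ b) ⟧) + ∑ A (λ q → ⟦ does (dot χ q ≟ not b) ⟧)
      ≡⟨ ∑-+ (λ q → ⟦ does (dot χ q ≟ b) ⟧) (λ q → ⟦ does (dot χ q ≟ not b) ⟧) A ⟨
    ∑ A (λ q → ⟦ does (dot χ q ≟ b) ⟧ + ⟦ does (dot χ q ≟ not b) ⟧)
      ≡⟨ ∑-cong A (λ q → cases (dot χ q) b) ⟩
    ∑ A (λ _ → 1)
      ≡⟨ ∑-1 A ⟩
    length A ∎
    where
    open ≡-Reasoning
    cases : ∀ x b → ⟦ does (x ≟ b) ⟧ + ⟦ does (x ≟ not b) ⟧ ≡ 1
    cases false false = refl
    cases false true  = refl
    cases true  false = refl
    cases true  true  = refl

  -- A point q ≠ p agrees with p on exactly half of the cube.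
  ∑-agreement : Simple A → ∀ p →
    2 * ∑ (cube v) (λ χ → length (section χ (dot χ p) A)) ≤ 2 ^ v * (length A + 1)
  ∑-agreement simple p = begin
    2 * ∑ (cube v) (λ χ → length (section χ (dot χ p) A))
      ≡⟨ cong (2 *_) (∑-cong (cube v) (λ χ → length-section χ (dot χ p) A)) ⟩
    2 * ∑ (cube v) (λ χ → ∑ A (λ q → agree χ q p))
      ≡⟨ cong (2 *_) (∑-swap (λ χ q → agree χ q p) (cube v) A) ⟩
    2 * ∑ A (λ q → ∑ (cube v) (λ χ → agree χ q p))
      ≡⟨ ∑-*ˡ 2 (λ q → ∑ (cube v) (λ χ → agree χ q p)) A ⟨
    ∑ A (λ q → 2 * ∑ (cube v) (λ χ → agree χ q p))
      ≤⟨ ∑-mono A (λ q → ∑-agree q p) ⟩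
    ∑ A (λ q → 2 ^ v * (1 + [ p ≈ q ]))
      ≡⟨ ∑-*ˡ (2 ^ v) (λ q → 1 + [ p ≈ q ]) A ⟩
    2 ^ v * ∑ A (λ q → 1 + [ p ≈ q ])
      ≡⟨ cong (2 ^ v *_) (trans (∑-+ (λ _ → 1) [ p ≈_] A) (cong (_+ ∑ A [ p ≈_]) (∑-1 A))) ⟩
    2 ^ v * (length A + ∑ A [ p ≈_])
      ≤⟨ *-monoʳ-≤ (2 ^ v) (+-monoʳ-≤ (length A) (simple p)) ⟩
    2 ^ v * (length A + 1) ∎
    where open ≤-Reasoning

-- Induction for the weight gap

-- The bound is twice the minimum weight 2^n of the code. The empty word is included, with `j` = n +
-- 1.
WeightGap : ℕ → Set
WeightGap n = ∀ {v} (A : List (Subset v)) → Null n A → Simple A →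
  length A < 2 ^ suc n → ∃[ j ] length A + 2 ^ j ≡ 2 ^ suc n

null⇒even : ∀ {v n} (A : List (Subset v)) → Null (suc n) A → 2 ∣ length A
null⇒even {v} A null =
  subst (2 ∣_) (degree-⊥ A) (null Subset.⊥ (s≤s (≤-trans (≤-reflexive (∣⊥∣≡0 v)) z≤n)))

-- Refutes a deficiency `e` that is not a power of two. `gap₁` is applied to sections by one
-- hyperplane, `gap₀` to sections by two.
module Step {n} (gap₀ : WeightGap n) (gap₁ : WeightGap (suc n))
            {v} (A : List (Subset v)) (null : Null (suc (suc n)) A) (simple : Simple A)
            (e : ℕ) (total : length A + e ≡ 2 ^ suc (suc (suc n))) (0<e : 0 < e)
            (e≢2^ : ¬ IsPower e) where

  d : ℕ
  d = 2 ^ suc (suc n)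

  # : Subset v → Bool → ℕ
  # χ b = length (section χ b A)

  total′ : length A + e ≡ d + d
  total′ = trans total (2^-suc (suc (suc n)))

  small-section : ∀ χ b → # χ b < d → ∃[ c ] # χ b + 2 ^ c ≡ d
  small-section χ b = gap₁ (section χ b A) (null-section (suc n) χ b A null) (simple-section χ b A simple)

  -- Both halves are words of the next lower level, so `half-split` applies. The strict inequality
  -- is kept for the averaging in `impossible`.
  minority : ∀ χ → ∃[ b ] ∃[ c ] # χ b + 2 ^ c ≡ d × Fits e c × # χ b < # χ (not b)
  minority χ with ≤-total (# χ false) (# χ true)
  ... | inj₁ f≤t = false , half-split (trans (cong (_+ e) (length-sections A χ false)) total′)
                     0<e f≤t (small-section χ false) (small-section χ true) e≢2^
  ... | inj₂ t≤f = true , half-split (trans (cong (_+ e) (length-sections A χ true)) total′)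
                     0<e t≤f (small-section χ true) (small-section χ false) e≢2^

  μ : Subset v → Bool
  μ χ = proj₁ (minority χ)

  -- If the minority values add up, each q lies in exactly one or in all three of
  -- the minority halves, so their sizes sum to |A| + 2 N for the common part N.
  μ-⊕-≢ : ∀ χ ψ → μ (χ ⊕ ψ) ≢ μ χ xor μ ψ
  μ-⊕-≢ χ ψ μ₃≡ with minority χ | minority ψ | minority (χ ⊕ ψ)
  ... | b₁ , c₁ , m₁ , f₁ , _ | b₂ , c₂ , m₂ , f₂ , _ | _ , c₃ , m₃ , f₃ , _
    -- The exponent is `suc l` because doubling N + 2^l = d/2 gives 2 N + 2^(l+1) = d.
    rewrite μ₃≡ = powers-≢ {e} {suc l} 0<e f₁ f₂ f₃ e+2^l≡X
    where
    N X : ℕ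
    N = length (section ψ b₂ (section χ b₁ A))
    X = 2 ^ c₁ + (2 ^ c₂ + 2 ^ c₃)
    -- Filling each of the three halves up to `d` gives |A| + 2 N + X = 3 d, where 2 d = |A| + e.
    2N+X≡e+d : 2 * N + X ≡ e + d
    2N+X≡e+d = +-cancelˡ-≡ (length A) _ _ (begin
      length A + (2 * N + X)
        ≡⟨ +-assoc (length A) (2 * N) X ⟨
      length A + 2 * N + X
        ≡⟨ cong (_+ X) (minority-sum A χ ψ b₁ b₂) ⟨
      # χ b₁ + (# ψ b₂ + # (χ ⊕ ψ) (b₁ xor b₂)) + X
        ≡⟨ interchange (# χ b₁) (# ψ b₂) (# (χ ⊕ ψ) (b₁ xor b₂)) (2 ^ c₁) (2 ^ c₂) (2 ^ c₃) ⟩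
      # χ b₁ + 2 ^ c₁ + (# ψ b₂ + 2 ^ c₂ + (# (χ ⊕ ψ) (b₁ xor b₂) + 2 ^ c₃))
        ≡⟨ cong₂ _+_ m₁ (cong₂ _+_ m₂ m₃) ⟩
      d + (d + d)
        ≡⟨ cong (d +_) total′ ⟨
      d + (length A + e)
        ≡⟨ rotate d (length A) e ⟩
      length A + (e + d) ∎)
      where
      open ≡-Reasoning
      interchange : ∀ a b c x y z → a + (b + c) + (x + (y + z)) ≡ a + x + (b + y + (c + z))
      interchange = solve-∀
      rotate : ∀ x y z → x + (y + z) ≡ y + (z + x)
      rotate = solve-∀
    -- Averaging e < 2 · 2^c₁ and e < 2 · 2^c₂ already gives e < 2^c₁ + 2^c₂.
    e<X : e < X
    e<X = <-≤-trans
      (*-cancelˡ-< 2 e (2 ^ c₁ + 2 ^ c₂)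
        (subst₂ _<_ (double e) (regroup (2 ^ c₁) (2 ^ c₂)) (+-mono-< (fits⇒< f₁) (fits⇒< f₂))))
      (≤-trans (m≤m+n _ (2 ^ c₃)) (≤-reflexive (+-assoc (2 ^ c₁) (2 ^ c₂) (2 ^ c₃))))
      where
      double : ∀ x → x + x ≡ 2 * x
      double = solve-∀
      regroup : ∀ x y → x + x + (y + y) ≡ 2 * (x + y)
      regroup = solve-∀
    N<d/2 : N < 2 ^ suc n
    N<d/2 = *-cancelˡ-< 2 N (2 ^ suc n)
      (≰⇒> λ d≤2N → <-irrefl (trans (+-comm d e) (sym 2N+X≡e+d)) (+-mono-≤-< d≤2N e<X))
    common : ∃[ l ] N + 2 ^ l ≡ 2 ^ suc n
    common = gap₀ (section ψ b₂ (section χ b₁ A))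
      (null-section n ψ b₂ (section χ b₁ A) (null-section (suc n) χ b₁ A null))
      (simple-section ψ b₂ (section χ b₁ A) (simple-section χ b₁ A simple)) N<d/2
    l : ℕ
    l = proj₁ common
    e+2^l≡X : e + 2 ^ suc l ≡ X
    e+2^l≡X = +-cancelˡ-≡ (2 * N) _ _ (begin
      2 * N + (e + 2 ^ suc l)   ≡⟨ regroup N e (2 ^ l) ⟩
      e + 2 * (N + 2 ^ l)       ≡⟨ cong (λ x → e + 2 * x) (proj₂ common) ⟩
      e + d                     ≡⟨ 2N+X≡e+d ⟨
      2 * N + X                 ∎)
      where
      open ≡-Reasoning
      regroup : ∀ x y z → 2 * x + (y + 2 * z) ≡ y + 2 * (x + z)
      regroup = solve-∀

  -- By `μ-⊕-≢` the minority values add up with an extra 1 on each pair, which complementing all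
  -- three values absorbs.
  majority-linear : ∀ χ ψ → not (μ (χ ⊕ ψ)) ≡ not (μ χ) xor not (μ ψ)
  majority-linear χ ψ = begin
    not (μ (χ ⊕ ψ))            ≡⟨ cong not (¬-not (μ-⊕-≢ χ ψ)) ⟩
    not (not (μ χ xor μ ψ))    ≡⟨ not-involutive (μ χ xor μ ψ) ⟩
    μ χ xor μ ψ                ≡⟨ xor-annihilates-not (μ χ) (μ ψ) ⟨
    not (μ χ) xor not (μ ψ)    ∎
    where open ≡-Reasoning

  -- With |A| = 2 a, every majority half has at least a + 1 points. The average of the halves
  -- containing `p` would then be at least (|A| + 2) / 2, above the bound (|A| + 1) / 2 of
  -- `∑-agreement`.
  impossible : ∃[ p ] (∀ χ → not (μ χ) ≡ dot χ p) → 2 ∣ length A → ⊥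
  impossible (p , majority) (divides a L≡a*2) = <⇒≱ (*-monoʳ-< (2 ^ v) ⦃ m^n≢0 2 v ⦄ (n<1+n (length A + 1))) (begin
    2 ^ v * suc (length A + 1)
      ≡⟨ cong (λ x → 2 ^ v * suc (x + 1)) L≡a*2 ⟩
    2 ^ v * suc (a * 2 + 1)
      ≡⟨ regroup (2 ^ v) a ⟩
    2 * (2 ^ v * suc a)
      ≡⟨ cong (λ x → 2 * (x * suc a)) (length-cube v) ⟨
    2 * (length (cube v) * suc a)
      ≡⟨ cong (2 *_) (∑-const (suc a) (cube v)) ⟨
    2 * ∑ (cube v) (λ _ → suc a)
      ≤⟨ *-monoʳ-≤ 2 (∑-mono (cube v) large) ⟩
    2 * ∑ (cube v) (λ χ → # χ (dot χ p))
      ≤⟨ ∑-agreement A simple p ⟩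
    2 ^ v * (length A + 1) ∎)
    where
    open ≤-Reasoning
    regroup : ∀ x a → x * suc (a * 2 + 1) ≡ 2 * (x * suc a)
    regroup = solve-∀
    large : ∀ χ → a < # χ (dot χ p)
    large χ rewrite sym (majority χ) = *-cancelʳ-< 2 a (# χ (not (μ χ))) (begin-strict
      a * 2                              ≡⟨ L≡a*2 ⟨
      length A                           ≡⟨ length-sections A χ (μ χ) ⟨
      # χ (μ χ) + # χ (not (μ χ))        <⟨ +-monoˡ-< _ (proj₂ (proj₂ (proj₂ (proj₂ (minority χ))))) ⟩
      # χ (not (μ χ)) + # χ (not (μ χ))  ≡⟨ double (# χ (not (μ χ))) ⟩
      # χ (not (μ χ)) * 2                ∎)
      where
      double : ∀ x → x + x ≡ x * 2
      double = solve-∀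

  contradictory : ⊥
  contradictory = impossible (linear⇒dot (not ∘ μ) majority-linear) (null⇒even A null)

gap-step : ∀ {n} → WeightGap n → WeightGap (suc n) → WeightGap (suc (suc n))
gap-step {n} gap₀ gap₁ A null simple small with isPower? (2 ^ suc (suc (suc n)) ∸ length A)
... | yes (j , e≡2^j) = j , trans (cong (length A +_) (sym e≡2^j)) (m+[n∸m]≡n (<⇒≤ small))
... | no e≢2^ = ⊥-elim (Step.contradictory gap₀ gap₁ A null simple
  (2 ^ suc (suc (suc n)) ∸ length A) (m+[n∸m]≡n (<⇒≤ small)) (m<n⇒0<n∸m small) e≢2^)

-- Two base cases, since the step uses the two preceding levels. At level 0 only the lengths 0 and 1
-- are possible, and at level 1 parity leaves 0 and 2.
weightGap : ∀ n → WeightGap n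
weightGap zero A null simple small with length A
... | 0 = 1 , refl
... | 1 = 0 , refl
... | suc (suc _) = ⊥-elim (<⇒≱ small (s≤s (s≤s z≤n)))
weightGap (suc zero) A null simple small with length A | null⇒even A null
... | 0 | _ = 2 , refl
... | 1 | 2∣1 = ⊥-elim (1+n≰n (∣⇒≤ 2∣1))
... | 2 | _ = 1 , refl
... | 3 | 2∣3 = ⊥-elim (1+n≰n (∣⇒≤ (∣m+n∣m⇒∣n 2∣3 (divides 1 refl))))
... | suc (suc (suc (suc _))) | _ = ⊥-elim (<⇒≱ small (s≤s (s≤s (s≤s (s≤s z≤n)))))
weightGap (suc (suc n)) = gap-step (weightGap n) (weightGap (suc n))

-- Balance of trades on smaller sets

∑-cong-All : ∀ {f g : A → ℕ} {xs} → All (λ x → f x ≡ g x) xs → ∑ xs f ≡ ∑ xs g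
∑-cong-All []         = refl
∑-cong-All (eq ∷ eqs) = cong₂ _+_ eq (∑-cong-All eqs)

-- Double counting of the pairs of a block `B` containing `S` and a point `i` of `B`.
∑-degree-∪⁅⁆ : ∀ {v k} (S : Subset v) {T} → All (λ B → ∣ B ∣ ≡ k) T →
  ∑ (allFin v) (λ i → degree (S ∪ ⁅ i ⁆) T) ≡ k * degree S T
∑-degree-∪⁅⁆ {v} {k} S {T} blocks = begin
  ∑ (allFin v) (λ i → degree (S ∪ ⁅ i ⁆) T)
    ≡⟨ ∑-cong (allFin v) (λ i → trans (degree-∑ (S ∪ ⁅ i ⁆) T) (∑-cong T (λ B → ∪⁅⁆-⊆ S B i))) ⟩
  ∑ (allFin v) (λ i → ∑ T (λ B → [ i ∈ B ] * [ S ⊆ B ]))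
    ≡⟨ ∑-swap (λ i B → [ i ∈ B ] * [ S ⊆ B ]) (allFin v) T ⟩
  ∑ T (λ B → ∑ (allFin v) (λ i → [ i ∈ B ] * [ S ⊆ B ]))
    ≡⟨ ∑-cong T (λ B → trans (∑-*ʳ [ S ⊆ B ] [_∈ B ] (allFin v)) (cong (_* [ S ⊆ B ]) (∑-allFin B))) ⟩
  ∑ T (λ B → ∣ B ∣ * [ S ⊆ B ])
    ≡⟨ ∑-cong-All (All.map (λ {B} eq → cong (_* [ S ⊆ B ]) eq) blocks) ⟩
  ∑ T (λ B → k * [ S ⊆ B ])
    ≡⟨ ∑-*ˡ k [ S ⊆_] T ⟩
  k * ∑ T [ S ⊆_]
    ≡⟨ cong (k *_) (degree-∑ S T) ⟨
  k * degree S T ∎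
  where open ≡-Reasoning

module _ {v k} {T₁ T₂ : List (Subset v)}
         (blocks₁ : All (λ B → ∣ B ∣ ≡ k) T₁) (blocks₂ : All (λ B → ∣ B ∣ ≡ k) T₂) where

  -- In the double count, each `i` in `S` contributes the degree of `S` itself and every other `i`
  -- contributes equally for both lists. Hence the two degrees of `S` agree after multiplication by
  -- k - |S| > 0.
  balanced-step : ∀ S → ∣ S ∣ < k →
    (∀ i → lookup S i ≡ false → degree (S ∪ ⁅ i ⁆) T₁ ≡ degree (S ∪ ⁅ i ⁆) T₂) →
    degree S T₁ ≡ degree S T₂
  balanced-step S ∣S∣<k above = *-cancelˡ-≡ D₁ D₂ m ⦃ >-nonZero (m<n⇒0<n∸m ∣S∣<k) ⦄
    (+-cancelˡ-≡ (s * (D₁ + D₂)) _ _ (begin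
      s * (D₁ + D₂) + m * D₁        ≡⟨ regroup s m D₁ D₂ ⟩
      (s + m) * D₁ + s * D₂         ≡⟨ cong (λ x → x * D₁ + s * D₂) s+m≡k ⟩
      k * D₁ + s * D₂               ≡⟨ weighted blocks₁ D₂ ⟨
      -- Each side receives the other's degree at the points of `S`, so the sums agree term by term
      -- without subtraction.
      ∑ (allFin v) (λ i → degree (S ∪ ⁅ i ⁆) T₁ + [ i ∈ S ] * D₂)
                                    ≡⟨ ∑-cong (allFin v) pointwise ⟩
      ∑ (allFin v) (λ i → degree (S ∪ ⁅ i ⁆) T₂ + [ i ∈ S ] * D₁)
                                    ≡⟨ weighted blocks₂ D₁ ⟩
      k * D₂ + s * D₁               ≡⟨ cong (λ x → x * D₂ + s * D₁) s+m≡k ⟨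
      (s + m) * D₂ + s * D₁         ≡⟨ regroup s m D₂ D₁ ⟨
      s * (D₂ + D₁) + m * D₂        ≡⟨ cong (λ x → s * x + m * D₂) (+-comm D₂ D₁) ⟩
      s * (D₁ + D₂) + m * D₂        ∎))
    where
    open ≡-Reasoning
    s m D₁ D₂ : ℕ
    s = ∣ S ∣
    m = k ∸ s
    D₁ = degree S T₁
    D₂ = degree S T₂
    s+m≡k : s + m ≡ k
    s+m≡k = m+[n∸m]≡n (<⇒≤ ∣S∣<k)
    regroup : ∀ s m x y → s * (x + y) + m * x ≡ (s + m) * x + s * y
    regroup = solve-∀
    weighted : ∀ {T} → All (λ B → ∣ B ∣ ≡ k) T → ∀ D →
      ∑ (allFin v) (λ i → degree (S ∪ ⁅ i ⁆) T + [ i ∈ S ] * D) ≡ k * degree S T + s * D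
    weighted {T} blocks D =
      trans (∑-+ (λ i → degree (S ∪ ⁅ i ⁆) T) (λ i → [ i ∈ S ] * D) (allFin v))
        (cong₂ _+_ (∑-degree-∪⁅⁆ S blocks)
          (trans (∑-*ʳ D [_∈ S ] (allFin v)) (cong (_* D) (∑-allFin S))))
    pointwise : ∀ i → degree (S ∪ ⁅ i ⁆) T₁ + [ i ∈ S ] * D₂ ≡ degree (S ∪ ⁅ i ⁆) T₂ + [ i ∈ S ] * D₁
    pointwise i with lookup S i in eq
    ... | false = cong (_+ 0) (above i eq)
    ... | true rewrite ∪⁅⁆-absorb S i eq = swap D₁ D₂
      where
      swap : ∀ x y → x + 1 * y ≡ y + 1 * x
      swap = solve-∀

  -- Descends from sets of size `t`, with `m` counting the points still missing from `S`.
  balanced-below : ∀ {t} → t < k → (∀ S → ∣ S ∣ ≡ t → degree S T₁ ≡ degree S T₂) →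
    ∀ S → ∣ S ∣ ≤ t → degree S T₁ ≡ degree S T₂
  balanced-below {t} t<k balanced S ∣S∣≤t = descend (t ∸ ∣ S ∣) S (m+[n∸m]≡n ∣S∣≤t)
    where
    descend : ∀ m S → ∣ S ∣ + m ≡ t → degree S T₁ ≡ degree S T₂
    descend zero    S eq = balanced S (trans (sym (+-identityʳ ∣ S ∣)) eq)
    descend (suc m) S eq = balanced-step S
      (≤-<-trans (m+n≤o⇒m≤o ∣ S ∣ (≤-reflexive eq)) t<k)
      (λ i i∉S → descend m (S ∪ ⁅ i ⁆)
        (trans (cong (_+ m) (∣∪⁅⁆∣ S i i∉S)) (trans (sym (+-suc ∣ S ∣ m)) eq)))

-- Steiner trades as words of the code

facet : ∀ {v t} (p : Subset v) → ∣ p ∣ ≡ suc t → ∃[ S ] S ⊆ p × ∣ S ∣ ≡ t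
facet (true  ∷ p) eq = false ∷ p , out⊆ (λ x∈p → x∈p) , suc-injective eq
facet (false ∷ p) eq with facet p eq
... | S , S⊆p , ∣S∣≡t = false ∷ S , out⊆ S⊆p , ∣S∣≡t

multiplicity>0⇒∈ : ∀ {v} (p : Subset v) T → ∑ T [ p ≈_] ≢ 0 → p List.∈ T
multiplicity>0⇒∈ p []      ≢0 = ⊥-elim (≢0 refl)
multiplicity>0⇒∈ p (q ∷ T) ≢0 with point? p q
... | yes p≡q = here p≡q
... | no  _   = there (multiplicity>0⇒∈ p T ≢0)

multiplicity≤degree : ∀ {v} {S p : Subset v} → S ⊆ p → ∀ T → ∑ T [ p ≈_] ≤ degree S T
multiplicity≤degree {S = S} {p} S⊆p T = ≤-trans (∑-mono T pointwise) (≤-reflexive (sym (degree-∑ S T)))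
  where
  pointwise : ∀ q → [ p ≈ q ] ≤ [ S ⊆ q ]
  pointwise q with point? p q
  ... | no  _    = z≤n
  ... | yes refl rewrite dec-true (S ⊆? p) S⊆p = ≤-refl

-- A point that occurs in `T` is a block and contains some `t`-set, whose degree counts every copy
-- of that block.
steiner⇒simple : ∀ {v t} {T : List (Subset v)} → All (λ B → ∣ B ∣ ≡ suc t) T →
  (∀ S → ∣ S ∣ ≡ t → degree S T ≤ 1) → Simple T
steiner⇒simple {T = T} blocks steiner p with ∑ T [ p ≈_] ℕ.≟ 0
... | yes ≡0 = ≤-trans (≤-reflexive ≡0) z≤n
... | no  ≢0 with facet p (All.lookup blocks (multiplicity>0⇒∈ p T ≢0))
... | S , S⊆p , ∣S∣≡t = ≤-trans (multiplicity≤degree S⊆p T) (steiner S ∣S∣≡t)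

simple-++ : ∀ {v} {T₁ T₂ : List (Subset v)} → Disjoint T₁ T₂ → Simple T₁ → Simple T₂ →
  Simple (T₁ ++ T₂)
simple-++ {T₁ = T₁} {T₂} disjoint simple₁ simple₂ p
  rewrite ∑-++ [ p ≈_] T₁ T₂ with ∑ T₁ [ p ≈_] ℕ.≟ 0 | ∑ T₂ [ p ≈_] ℕ.≟ 0
... | yes ≡0 | _      rewrite ≡0 = simple₂ p
... | no  _  | yes ≡0 rewrite ≡0 | +-identityʳ (∑ T₁ [ p ≈_]) = simple₁ p
... | no ≢0₁ | no ≢0₂ = ⊥-elim (disjoint (multiplicity>0⇒∈ p T₁ ≢0₁ , multiplicity>0⇒∈ p T₂ ≢0₂))

-- The gap theorem at level t + 1 applies to `T₁ ++ T₂`: by balance its degrees on sets of size at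
-- most `t` are twice those of `T₁`. The resulting equation is then halved.
steiner-volume : ∀ {t v} (T : Trade t v (t + 1)) → IsSteiner T → volume T < 2 ^ (t + 1) →
  ∃[ j ] volume T + 2 ^ j ≡ 2 ^ (t + 1)
steiner-volume {t} {v} T steiner small rewrite +-comm t 1 =
  halve (weightGap (suc t) (T₁ ++ T₂) null simple small′)
  where
  open Trade T
  below : ∀ S → ∣ S ∣ ≤ t → degree S T₁ ≡ degree S T₂
  below = balanced-below blocks₁ blocks₂ ≤-refl balanced
  length-≡ : length T₂ ≡ length T₁
  length-≡ = begin
    length T₂            ≡⟨ degree-⊥ T₂ ⟨
    degree Subset.⊥ T₂   ≡⟨ below Subset.⊥ (≤-trans (≤-reflexive (∣⊥∣≡0 v)) z≤n) ⟨
    degree Subset.⊥ T₁   ≡⟨ degree-⊥ T₁ ⟩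
    length T₁            ∎
    where open ≡-Reasoning
  length-A : length (T₁ ++ T₂) ≡ 2 * length T₁
  length-A = trans (length-++ T₁) (cong (length T₁ +_) (trans length-≡ (sym (+-identityʳ _))))
  null : Null (suc t) (T₁ ++ T₂)
  null S (s≤s ∣S∣≤t) = divides (degree S T₁) (begin
    degree S (T₁ ++ T₂)          ≡⟨ degree-++ S T₁ T₂ ⟩
    degree S T₁ + degree S T₂    ≡⟨ cong (degree S T₁ +_) (below S ∣S∣≤t) ⟨
    degree S T₁ + degree S T₁    ≡⟨ double (degree S T₁) ⟩
    degree S T₁ * 2              ∎)
    where
    open ≡-Reasoning
    double : ∀ x → x + x ≡ x * 2
    double = solve-∀
  simple : Simple (T₁ ++ T₂)
  simple = simple-++ disjoint
    (steiner⇒simple blocks₁ (λ S ∣S∣≡t → proj₁ (steiner S ∣S∣≡t)))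
    (steiner⇒simple blocks₂ (λ S ∣S∣≡t → proj₂ (steiner S ∣S∣≡t)))
  small′ : length (T₁ ++ T₂) < 2 ^ suc (suc t)
  small′ = subst (_< 2 ^ suc (suc t)) (sym length-A) (*-monoʳ-< 2 small)
  halve : ∃[ j ] length (T₁ ++ T₂) + 2 ^ j ≡ 2 ^ suc (suc t) → ∃[ j ] length T₁ + 2 ^ j ≡ 2 ^ suc t
  -- Here 2 |T₁| + 1 would be the even number 2^(t+2).
  halve (zero , eq) = ⊥-elim (1+n≰n (∣⇒≤ (∣m+n∣m⇒∣n {2} {2 * length T₁} {1}
    (subst (2 ∣_) (trans (sym eq) (cong (_+ 1) length-A)) (m∣m*n (2 ^ suc t)))
    (m∣m*n (length T₁)))))
  halve (suc j , eq) = j , *-cancelˡ-≡ _ _ 2 (trans (*-distribˡ-+ 2 (length T₁) (2 ^ j))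
    (trans (cong (_+ 2 ^ suc j) (sym length-A)) eq))

theorem2 : ∀ (t : ℕ) → 3 ≤ t → ∀ (i : ℕ) → i < t → ∀ (s : ℕ) →
    2 ^ (t + 1) ∸ 2 ^ (t ∸ i) < s → s < 2 ^ (t + 1) ∸ 2 ^ (t ∸ i ∸ 1) →
    ∀ (v : ℕ) → v > t + 1 →
    ¬ (∃[ T ] IsSteiner {t} {v} {t + 1} T × volume T ≡ s)
theorem2 t _ i _ s lower upper v _ (T , steiner , refl)
  with steiner-volume T steiner (<-≤-trans upper (m∸n≤m (2 ^ (t + 1)) (2 ^ (t ∸ i ∸ 1))))
-- Since s = 2^(t+1) - 2^j, the two bounds place `j` strictly between `t ∸ i ∸ 1` and `t ∸ i`, which
-- are consecutive.
... | j , s+2^j≡ = <⇒≱ j<t∸i (≤-trans (m≤n+m∸n (t ∸ i) 1) t∸i∸1<j)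
  where
  s≡ : s ≡ 2 ^ (t + 1) ∸ 2 ^ j
  s≡ = trans (sym (m+n∸n≡m s (2 ^ j))) (cong (_∸ 2 ^ j) s+2^j≡)
  j<t∸i : j < t ∸ i
  j<t∸i = 2^-cancel-< (∸-cancelʳ-< (subst (2 ^ (t + 1) ∸ 2 ^ (t ∸ i) <_) s≡ lower))
  t∸i∸1<j : t ∸ i ∸ 1 < j
  t∸i∸1<j = 2^-cancel-< (∸-cancelʳ-< (subst (_< 2 ^ (t + 1) ∸ 2 ^ (t ∸ i ∸ 1)) s≡ upper))
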